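{- Let $K$ be a field of characteristic $0$, let $n\ge1$, let $\mathbf{q}=(q_1,\dots,q_n)$ be formal variables subject only to $q_1\cdots q_n=1$, and let \[ \mathbf{e}_n(\mathbf{q})=\sum_{\sigma\in S_n}\frac{\prod_{j\in D(\sigma)} q_{\sigma(1)}\cdots q_{\sigma(j)}}{\prod_{i=1}^{n-1}\bigl(1-q_{\sigma(1)}\cdots q_{\sigma(i)}\bigr)}\,\sigma\in K(\mathbf{q})S_n . \] Then $\mathbf{e}_n(\mathbf{q})\ltimes\mathbf{e}_n(\mathbf{q})=\mathbf{e}_n(\mathbf{q})$, i.e. $\mathbf{e}_n(\mathbf{q})$ is idempotent in $K(\mathbf{q})S_n$ with the twisted product.
   Context: $K(\mathbf{q})$ is the field of rational functions over $K$ in $q_1,\dots,q_{n-1}$, with $q_n:=(q_1\cdots q_{n-1})^{ -1}$. For $\sigma\in S_n$, $D(\sigma)=\{i:1\le i\le n-1,\ \sigma(i)>\sigma(i+1)\}$. $K(\mathbf{q})S_n$ is the $K(\mathbf{q})$-vector space with basis $S_n$. $S_n$ acts on $K(\mathbf{q})$ by $\sigma\cdot f(q_1,\dots,q_n)=f(q_{\sigma(1)},\dots,q_{\sigma(n)})$ (this preserves the relation $q_1\cdots q_n=1$). The twisted product on $K(\mathbf{q})S_n$ is defined by $f\sigma\ltimes g\tau=(f\cdot(\sigma\cdot g))\,\sigma\tau$ for $f,g\in K(\mathbf{q})$, $\sigma,\tau\in S_n$, where $\sigma\tau$ is composition (apply $\tau$ first), extended bilinearly. -}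

module Defs where

open import Level using (Level; suc; _⊔_)
open import Data.Nat as ℕ using (ℕ; zero; _<ᵇ_)
import Data.Nat as N
open import Data.Bool using (Bool; true; false; if_then_else_)
open import Data.Fin as Fin using (Fin; toℕ)
open import Data.List as List using (List; []; _∷_; [_]; concatMap; map; take; cartesianProduct; filter)
open import Data.Vec as Vec using (Vec; lookup; toList; _∷ʳ_)
open import Data.Vec.Properties using (≡-dec)
open import Data.Product using (_×_; _,_; proj₁; proj₂)
open import Relation.Nullary using (¬_)
open import Relation.Binary.PropositionalEquality using (_≡_)
open import Algebra.Bundles using (CommutativeRing)

record Field (c ℓ : Level) : Set (suc (c ⊔ ℓ)) where
  field
    commutativeRing : CommutativeRing c ℓ
  open CommutativeRing commutativeRing public
  field
    _⁻¹      : Carrier → Carrier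
    ⁻¹-cong  : ∀ {x y} → x ≈ y → x ⁻¹ ≈ y ⁻¹
    1≉0      : ¬ (1# ≈ 0#)
    inverseʳ : ∀ x → ¬ (x ≈ 0#) → x * x ⁻¹ ≈ 1#

  ι : ℕ → Carrier
  ι zero      = 0#
  ι (N.suc k) = 1# + ι k

  HasCharZero : Set ℓ
  HasCharZero = ∀ k → ¬ (ι (N.suc k) ≈ 0#)

-- The symmetric group S_n, a permutation σ being the vector
-- (σ(1), …, σ(n)) (0-indexed in Agda).

Perm : ℕ → Set
Perm n = Vec (Fin n) n

insertAll : ∀ {a} {A : Set a} {n} → A → Vec A n → List (Vec A (N.suc n))
insertAll x Vec.[]       = [ x Vec.∷ Vec.[] ]
insertAll x (y Vec.∷ ys) = (x Vec.∷ y Vec.∷ ys) ∷ map (y Vec.∷_) (insertAll x ys)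

perms : (n : ℕ) → List (Perm n)
perms zero      = [ Vec.[] ]
perms (N.suc n) = concatMap (λ v → insertAll Fin.zero (Vec.map Fin.suc v)) (perms n)

_∘ₚ_ : ∀ {n} → Perm n → Perm n → Perm n
σ ∘ₚ τ = Vec.map (lookup σ) τ

descBits : ∀ {n} → List (Fin n) → List Bool
descBits (a ∷ b ∷ rest) = (toℕ b <ᵇ toℕ a) ∷ descBits (b ∷ rest)
descBits _              = []

module Twisted {c ℓ} (L : Field c ℓ) where
  open Field L

  prodL : List Carrier → Carrier
  prodL = List.foldr _*_ 1#

  sumL : List Carrier → Carrier
  sumL = List.foldr _+_ 0#

  partials : Carrier → List Carrier → List Carrier
  partials acc []       = []
  partials acc (x ∷ xs) = (acc * x) ∷ partials (acc * x) xs

  fullQ : ∀ {m} → Vec Carrier m → Fin (N.suc m) → Carrier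
  fullQ q = lookup (q ∷ʳ (prodL (toList q)) ⁻¹)

  module _ {m : ℕ} where
    n = N.suc m

    prefixProds : (Fin n → Carrier) → Perm n → List Carrier
    prefixProds q σ = take m (partials 1# (map q (toList σ)))

    numer : (Fin n → Carrier) → Perm n → Carrier
    numer q σ = prodL (List.zipWith (λ b p → if b then p else 1#)
                                    (descBits (toList σ)) (prefixProds q σ))

    denom : (Fin n → Carrier) → Perm n → Carrier
    denom q σ = prodL (map (λ p → 1# - p) (prefixProds q σ))

    eCoeff : (Fin n → Carrier) → Perm n → Carrier
    eCoeff q σ = numer q σ * (denom q σ) ⁻¹

    -- Elements of L S_n whose coefficients are functions of (q₁,…,q_n);
    -- σ acts on a coefficient f by (σ·f)(q) = f(q_{σ(1)},…,q_{σ(n)}).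
    Elt : Set c
    Elt = (Fin n → Carrier) → Perm n → Carrier

    act : Perm n → ((Fin n → Carrier) → Carrier) → (Fin n → Carrier) → Carrier
    act σ f q = f (λ i → q (lookup σ i))

    _⋉_ : Elt → Elt → Elt
    (f ⋉ g) q τ =
      sumL (map (λ p → f q (proj₁ p) * act (proj₁ p) (λ q' → g q' (proj₂ p)) q)
                (filter (λ p → ≡-dec Fin._≟_ (proj₁ p ∘ₚ proj₂ p) τ)
                        (cartesianProduct (perms n) (perms n))))

{-# OPTIONS --safe #-}
module Submission where

-- Write P_j = q_τ(1) ⋯ q_τ(j). The denominators of the second factor are those of τ, and j is
-- a descent of σ⁻¹τ iff τ(j+1) precedes τ(j) in the word σ, so the claim at τ is
--     Σ_σ c(σ) ∏ { P_j : τ(j+1) precedes τ(j) in σ }  =  ∏ { P_j : j ∈ D(τ) },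
-- where c(σ) is the coefficient of σ. With each factor written as 1 + [τ(j+1) precedes τ(j)] (P_j − 1),
-- and σ built by inserting τ(n), …, τ(1) one at a time, the terms containing the summand 1
-- are sums of c over all shuffles of two nonempty complementary words. Such a sum is zero:
-- with one more cut counted at the front, the shuffle sum of c is multiplicative (as in the theory
-- of P-partitions), and q_1 ⋯ q_n = 1 cancels the two terms left by the first letter.
-- Only the word ω = τ(n) … τ(1) survives, contributing c(ω) ∏_j (P_j − 1) = ∏ { P_j : j ∈ D(τ) }.

open import Defs
open import Data.Nat as ℕ using (ℕ; zero; suc)
import Data.Nat.Properties as ℕ
open import Data.Bool using (Bool; true; false; if_then_else_; T)
open import Data.Fin as Fin using (Fin; toℕ)
import Data.Fin.Properties as Fin
open import Data.List using (List; []; _∷_; [_]; _++_; map; allFin; tabulate;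
  filter; concatMap; take; zipWith; cartesianProduct)
open import Data.List.Properties using (map-tabulate; map-∘; ≡-dec; ∷-injective)
open import Data.List.Membership.Propositional using (_∈_; _∉_; find; lose)
open import Data.List.Membership.Propositional.Properties
  using (∈-++⁺ʳ; ∈-concatMap⁺; ∈-concatMap⁻; ∈-map⁺; ∈-map⁻; ∈-∃++)
open import Data.List.Relation.Unary.All as All using (_∷_)
open import Data.List.Relation.Unary.All.Properties using (All¬⇒¬Any)
open import Data.List.Relation.Unary.AllPairs using (_∷_)
open import Data.List.Relation.Unary.Any using (here; there)
open import Data.List.Relation.Unary.Unique.Propositional using (Unique)
open import Data.List.Relation.Unary.Unique.Propositional.Properties using (allFin⁺)
open import Data.List.Relation.Binary.Disjoint.Propositional using (Disjoint)
open import Data.List.Relation.Binary.Permutation.Propositional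
  using (_↭_; prep; swap; ↭-refl; ↭-sym; ↭-trans; ↭-reflexive; ↭⇒↭ₛ)
  renaming (refl to ↭refl; trans to ↭trans)
open import Data.List.Relation.Binary.Permutation.Propositional.Properties
  using (shift; ++-comm; ++⁺ˡ; map⁺; drop-mid; ↭-map-inv; ∈-resp-↭; ¬x∷xs↭[]; ↭-empty-inv)
open import Data.List.Relation.Binary.Permutation.Setoid.Properties using (Unique-resp-↭)
open import Data.Product using (_×_; _,_; proj₁; proj₂; ∃-syntax)
open import Data.Vec as Vec using (Vec; lookup; toList; _∷ʳ_)
open import Data.Vec.Membership.Propositional.Properties using (∈-toList⁺; ∈-lookup)
import Data.Vec.Properties as Vec
open import Function using (_∘_)
open import Relation.Nullary using (¬_; yes; no; does; contradiction)
open import Relation.Nullary.Decidable using (dec-true; dec-false)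
open import Relation.Unary using (Pred; Decidable)
open import Relation.Binary.Definitions using (DecidableEquality; tri<; tri≈; tri>)
open import Relation.Binary.PropositionalEquality as ≡ using (_≡_; _≢_)

-- Words with distinct letters, and precedence of letters in a word.

++⇒disjoint : ∀ {a} {A : Set a} (u : List A) {v} → Unique (u ++ v) → Disjoint u v
++⇒disjoint (x ∷ u) (x≢ ∷ uniq) (here ≡.refl , j) = All¬⇒¬Any x≢ (∈-++⁺ʳ u j)
++⇒disjoint (x ∷ u) (x≢ ∷ uniq) (there i , j)     = ++⇒disjoint u uniq (i , j)

module _ {a} {A : Set a} (_≟_ : DecidableEquality A) where

  -- Testing for y before x gives `false` when x = y, in accordance with the strict comparison of
  -- positions.
  precedes : List A → A → A → Bool
  precedes []      x y = false
  precedes (z ∷ w) x y =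
    if does (z ≟ y) then false else if does (z ≟ x) then true else precedes w x y

  precedes-insert : ∀ {t x y} → t ≢ x → t ≢ y → ∀ α β →
    precedes (α ++ t ∷ β) x y ≡ precedes (α ++ β) x y
  precedes-insert {t} {x} {y} t≢x t≢y [] β
    rewrite dec-false (t ≟ y) t≢y | dec-false (t ≟ x) t≢x = ≡.refl
  precedes-insert {x = x} {y} t≢x t≢y (z ∷ α) β
    rewrite precedes-insert t≢x t≢y α β = ≡.refl

  -- Applied to the word σ, this turns a comparison of values of ρ, hence a descent of ρ, into a
  -- precedence between letters of σρ.
  precedes-lookup : ∀ {n} (v : Vec A n) → Unique (toList v) → ∀ i k →
    precedes (toList v) (lookup v i) (lookup v k) ≡ (toℕ i ℕ.<ᵇ toℕ k)
  precedes-lookup (z Vec.∷ v) _ i Fin.zero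
    rewrite dec-true (z ≟ z) ≡.refl = ≡.refl
  precedes-lookup (z Vec.∷ v) (z≢ ∷ _) Fin.zero (Fin.suc k)
    rewrite dec-false (z ≟ lookup v k) (All.lookup z≢ (∈-toList⁺ (∈-lookup k v)))
          | dec-true (z ≟ z) ≡.refl = ≡.refl
  precedes-lookup (z Vec.∷ v) (z≢ ∷ uniq) (Fin.suc i) (Fin.suc k)
    rewrite dec-false (z ≟ lookup v k) (All.lookup z≢ (∈-toList⁺ (∈-lookup k v)))
          | dec-false (z ≟ lookup v i) (All.lookup z≢ (∈-toList⁺ (∈-lookup i v))) =
    precedes-lookup v uniq i k

-- Sums over insertions, permutations and shuffles of words.

module WordSums {c ℓ} (L : Field c ℓ) where
  open Field L
  open import Relation.Binary.Reasoning.Setoid setoid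
  import Algebra.Solver.Ring.NaturalCoefficients.Default as NatSolver
  module Solver = NatSolver commutativeSemiring
  open Solver using (solve; _:=_; _:+_; _:*_)

  +-interchange : ∀ a b c d → (a + b) + (c + d) ≈ (a + c) + (b + d)
  +-interchange = solve 4 (λ a b c d → (a :+ b) :+ (c :+ d) := (a :+ c) :+ (b :+ d)) refl

  module _ {a} {A : Set a} where

    -- Sums over words are functionals in φ rather than lists: a letter fixed at the front is
    -- absorbed into φ, so each recursion returns to a sum of the same shape.
    insertSum : A → List A → (List A → Carrier) → Carrier
    insertSum t []      φ = φ [ t ]
    insertSum t (y ∷ w) φ = φ (t ∷ y ∷ w) + insertSum t w (φ ∘ (y ∷_))

    permSum : List A → (List A → Carrier) → Carrier
    permSum []      φ = φ []
    permSum (t ∷ l) φ = permSum l (λ w → insertSum t w φ)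

    shuffleSum : List A → List A → (List A → Carrier) → Carrier
    shuffleSum []      v       φ = φ v
    shuffleSum (a ∷ u) []      φ = φ (a ∷ u)
    shuffleSum (a ∷ u) (b ∷ v) φ =
      shuffleSum u (b ∷ v) (φ ∘ (a ∷_)) + shuffleSum (a ∷ u) v (φ ∘ (b ∷_))

    insertSum-cong : ∀ t w {φ ψ : List A → Carrier} →
      (∀ z → z ↭ t ∷ w → φ z ≈ ψ z) → insertSum t w φ ≈ insertSum t w ψ
    insertSum-cong t []      h = h _ ↭-refl
    insertSum-cong t (y ∷ w) h = +-cong (h _ ↭-refl)
      (insertSum-cong t w (λ z p → h _ (↭-trans (prep y p) (swap y t ↭-refl))))

    permSum-cong : ∀ l {φ ψ : List A → Carrier} →
      (∀ z → z ↭ l → φ z ≈ ψ z) → permSum l φ ≈ permSum l ψ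
    permSum-cong []      h = h _ ↭-refl
    permSum-cong (t ∷ l) h = permSum-cong l
      (λ w p → insertSum-cong t w (λ z p′ → h z (↭-trans p′ (prep t p))))

    -- Agreement is asked only on rearrangements of the letters, so that a function of the letter
    -- content, such as a weight, may be replaced by its constant value.
    shuffleSum-cong : ∀ u v {φ ψ : List A → Carrier} →
      (∀ z → z ↭ u ++ v → φ z ≈ ψ z) → shuffleSum u v φ ≈ shuffleSum u v ψ
    shuffleSum-cong []      v       h = h _ ↭-refl
    shuffleSum-cong (a ∷ u) []      h = h _ (↭-sym (++-comm (a ∷ u) []) )
    shuffleSum-cong (a ∷ u) (b ∷ v) h = +-cong
      (shuffleSum-cong u (b ∷ v) (λ z p → h _ (prep a p)))
      (shuffleSum-cong (a ∷ u) v
        (λ z p → h _ (↭-trans (prep b p) (↭-sym (shift b (a ∷ u) v)))))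

    insertSum-+ : ∀ t w (φ ψ : List A → Carrier) →
      insertSum t w (λ z → φ z + ψ z) ≈ insertSum t w φ + insertSum t w ψ
    insertSum-+ t []      φ ψ = refl
    insertSum-+ t (y ∷ w) φ ψ =
      trans (+-congˡ (insertSum-+ t w _ _)) (+-interchange _ _ _ _)

    -- Such a g does not see the letter t, so it equals g w on every term. Besides constants, this
    -- serves the cuts that do not involve t.
    insertSum-scale : ∀ t w (g φ : List A → Carrier) →
      (∀ α β → g (α ++ t ∷ β) ≈ g (α ++ β)) →
      insertSum t w (λ z → g z * φ z) ≈ g w * insertSum t w φ
    insertSum-scale t []      g φ inv = *-congʳ (inv [] [])
    insertSum-scale t (y ∷ w) g φ inv = trans
      (+-cong (*-congʳ (inv [] (y ∷ w)))
              (insertSum-scale t w (g ∘ (y ∷_)) (φ ∘ (y ∷_)) (λ α β → inv (y ∷ α) β)))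
      (sym (distribˡ _ _ _))

    permSum-scale : ∀ k l (φ : List A → Carrier) →
      permSum l (λ z → k * φ z) ≈ k * permSum l φ
    permSum-scale k []      φ = refl
    permSum-scale k (t ∷ l) φ = trans
      (permSum-cong l (λ w _ → insertSum-scale t w (λ _ → k) φ (λ _ _ → refl)))
      (permSum-scale k l _)

    shuffleSum-scale : ∀ k u v (φ : List A → Carrier) →
      shuffleSum u v (λ z → k * φ z) ≈ k * shuffleSum u v φ
    shuffleSum-scale k []      v       φ = refl
    shuffleSum-scale k (a ∷ u) []      φ = refl
    shuffleSum-scale k (a ∷ u) (b ∷ v) φ = trans
      (+-cong (shuffleSum-scale k u (b ∷ v) _) (shuffleSum-scale k (a ∷ u) v _))
      (sym (distribˡ _ _ _))

    shuffleSum-[] : ∀ u (φ : List A → Carrier) → shuffleSum u [] φ ≡ φ u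
    shuffleSum-[] []      φ = ≡.refl
    shuffleSum-[] (_ ∷ _) φ = ≡.refl

    insertSum-0 : ∀ t (w : List A) → insertSum t w (λ _ → 0#) ≈ 0#
    insertSum-0 t []      = refl
    insertSum-0 t (y ∷ w) = trans (+-identityˡ _) (insertSum-0 t w)

    insertSum-comm : ∀ s t w (φ : List A → Carrier) →
      insertSum s w (λ z → insertSum t z φ) ≈ insertSum t w (λ z → insertSum s z φ)
    insertSum-comm s t []      φ = +-comm _ _
    insertSum-comm s t (y ∷ w) φ = begin
      (φ (t ∷ s ∷ y ∷ w) + (φ (s ∷ t ∷ y ∷ w) + insertSum t w (φ ∘ (s ∷_) ∘ (y ∷_))))
        + insertSum s w (λ z → φ (t ∷ y ∷ z) + insertSum t z (φ ∘ (y ∷_)))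
        ≈⟨ +-congˡ (trans (insertSum-+ s w _ _) (+-congˡ (insertSum-comm s t w _))) ⟩
      (φ (t ∷ s ∷ y ∷ w) + (φ (s ∷ t ∷ y ∷ w) + insertSum t w (φ ∘ (s ∷_) ∘ (y ∷_))))
        + (insertSum s w (λ z → φ (t ∷ y ∷ z))
           + insertSum t w (λ z → insertSum s z (φ ∘ (y ∷_))))
        ≈⟨ solve 5 (λ a b c d e → (a :+ (b :+ c)) :+ (d :+ e) := (b :+ (a :+ d)) :+ (c :+ e))
             refl _ _ _ _ _ ⟩
      (φ (s ∷ t ∷ y ∷ w) + (φ (t ∷ s ∷ y ∷ w) + insertSum s w (λ z → φ (t ∷ y ∷ z))))
        + (insertSum t w (φ ∘ (s ∷_) ∘ (y ∷_))
           + insertSum t w (λ z → insertSum s z (φ ∘ (y ∷_))))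
        ≈⟨ +-congˡ (sym (insertSum-+ t w _ _)) ⟩
      (φ (s ∷ t ∷ y ∷ w) + (φ (t ∷ s ∷ y ∷ w) + insertSum s w (λ z → φ (t ∷ y ∷ z))))
        + insertSum t w (λ z → φ (s ∷ y ∷ z) + insertSum s z (φ ∘ (y ∷_)))
        ∎

    -- Adjacent swaps suffice, and two insertions commute. This frees the order in which the letters
    -- are inserted.
    permSum-↭ : ∀ {l l′} (φ : List A → Carrier) → l ↭ l′ → permSum l φ ≈ permSum l′ φ
    permSum-↭ φ ↭refl        = refl
    permSum-↭ φ (prep x p)   = permSum-↭ _ p
    permSum-↭ {l = _ ∷ _ ∷ l} φ (swap x y p) =
      trans (permSum-cong l (λ w _ → insertSum-comm y x w φ)) (permSum-↭ _ p)
    permSum-↭ φ (↭trans p q) = trans (permSum-↭ φ p) (permSum-↭ φ q)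

  module _ {a b} {A : Set a} {B : Set b} (f : A → B) where

    insertSum-map : ∀ t w (φ : List B → Carrier) →
      insertSum (f t) (map f w) φ ≡ insertSum t w (φ ∘ map f)
    insertSum-map t []      φ = ≡.refl
    insertSum-map t (y ∷ w) φ = ≡.cong (_ +_) (insertSum-map t w _)

    permSum-map : ∀ l (φ : List B → Carrier) →
      permSum (map f l) φ ≈ permSum l (φ ∘ map f)
    permSum-map []      φ = refl
    permSum-map (t ∷ l) φ = trans (permSum-map l _)
      (permSum-cong l (λ w _ → reflexive (insertSum-map t w φ)))

  -- Shuffles behind a given letter, and indicator sums.

  module _ {a} {A : Set a} (_≟_ : DecidableEquality A) where

    -- For σ = α t β: the sum of φ (α t w) over the shuffles w of r and β.
    shuffleAfter : A → List A → List A → (List A → Carrier) → Carrier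
    shuffleAfter t r []      φ = 0#
    shuffleAfter t r (y ∷ w) φ =
      if does (y ≟ t) then shuffleSum r w (φ ∘ (y ∷_)) else shuffleAfter t r w (φ ∘ (y ∷_))

    -- With r empty there is nothing to shuffle, so a plain summand φ w takes the form from which
    -- the induction starts.
    shuffleAfter-[] : ∀ {t} w (φ : List A → Carrier) → t ∈ w →
      shuffleAfter t [] w φ ≡ φ w
    shuffleAfter-[] {t} (y ∷ w) φ t∈ with y ≟ t | t∈
    ... | yes _  | _            = ≡.refl
    ... | no y≢t | here ≡.refl  = contradiction ≡.refl y≢t
    ... | no _   | there t∈w    = shuffleAfter-[] w (φ ∘ (y ∷_)) t∈w

    -- A shuffle of t ∷ r and w amounts to a place for t in w and a shuffle of r with the letters of
    -- w behind that place.
    insertSum-shuffleAfter : ∀ t r w φ → t ∉ w →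
      insertSum t w (λ z → shuffleAfter t r z φ) ≈ shuffleSum (t ∷ r) w φ
    insertSum-shuffleAfter t r [] φ t∉
      rewrite dec-true (t ≟ t) ≡.refl = reflexive (shuffleSum-[] r _)
    insertSum-shuffleAfter t r (y ∷ w) φ t∉
      rewrite dec-true (t ≟ t) ≡.refl | dec-false (y ≟ t) (t∉ ∘ here ∘ ≡.sym) =
      +-congˡ (insertSum-shuffleAfter t r w (φ ∘ (y ∷_)) (t∉ ∘ there))

    -- The same decomposition, with t confined to the places behind t′: the part of w up to t′ stays
    -- fixed, and t ∷ r is shuffled with the rest.
    insertSum-shuffleAfter-precedes : ∀ t t′ r w φ → t ≢ t′ → t ∉ w →
      insertSum t w (λ z → if precedes _≟_ z t′ t then shuffleAfter t r z φ else 0#)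
        ≈ shuffleAfter t′ (t ∷ r) w φ
    insertSum-shuffleAfter-precedes t t′ r [] φ t≢t′ t∉
      rewrite dec-true (t ≟ t) ≡.refl = refl
    insertSum-shuffleAfter-precedes t t′ r (y ∷ w) φ t≢t′ t∉
      rewrite dec-true (t ≟ t) ≡.refl | dec-false (y ≟ t) (t∉ ∘ here ∘ ≡.sym)
      with does (y ≟ t′)
    ... | true  = trans (+-identityˡ _) (insertSum-shuffleAfter t r w (φ ∘ (y ∷_)) (t∉ ∘ there))
    ... | false = trans (+-identityˡ _)
      (insertSum-shuffleAfter-precedes t t′ r w (φ ∘ (y ∷_)) t≢t′ (t∉ ∘ there))

    insertSum-δ : ∀ t w l k → t ∉ w →
      insertSum t w (λ z → if does (≡-dec _≟_ z (t ∷ l)) then k else 0#)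
        ≈ (if does (≡-dec _≟_ w l) then k else 0#)
    insertSum-δ t [] l k t∉ rewrite dec-true (t ≟ t) ≡.refl = refl
    insertSum-δ t (y ∷ w) l k t∉
      rewrite dec-true (t ≟ t) ≡.refl | dec-false (y ≟ t) (t∉ ∘ here ∘ ≡.sym) =
      trans (+-congˡ (insertSum-0 t w)) (+-identityʳ _)

    -- Distinct letters make l occur exactly once; this selects the single ρ with σρ = τ.
    permSum-δ : ∀ l k → Unique l →
      permSum l (λ w → if does (≡-dec _≟_ w l) then k else 0#) ≈ k
    permSum-δ []      k uniq = refl
    permSum-δ (t ∷ l) k (t≢ ∷ uniq) = trans
      (permSum-cong l (λ w p →
        insertSum-δ t w l k (λ t∈w → All¬⇒¬Any t≢ (∈-resp-↭ p t∈w))))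
      (permSum-δ l k uniq)

-- Shuffle sums of the coefficients: multiplicativity and vanishing.

module Klyachko {c ℓ} (L : Field c ℓ) {n : ℕ} (q : Fin n → Field.Carrier L) where
  open Field L
  open Twisted L using (prodL)
  open WordSums L
  open import Relation.Binary.Reasoning.Setoid setoid
  open Solver using (solve; _:=_; _:+_; _:*_; con)
  open import Algebra.Properties.Ring ring using (+-cancelˡ; x[y-z]≈xy-xz)
  open import Algebra.Properties.AbelianGroup +-abelianGroup using (x∙y⁻¹≈ε⇒x≈y)

  _⟨_⟩ : Bool → Carrier → Carrier
  b ⟨ x ⟩ = if b then x else 1#

  ⟨⟩-cong : ∀ b {x y} → x ≈ y → b ⟨ x ⟩ ≈ b ⟨ y ⟩
  ⟨⟩-cong true  e = e
  ⟨⟩-cong false e = refl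

  _≺_ : Fin n → Fin n → Bool
  a ≺ b = toℕ a ℕ.<ᵇ toℕ b

  weight : List (Fin n) → Carrier
  weight w = prodL (map q w)

  weight-↭ : ∀ {u v} → u ↭ v → weight u ≈ weight v
  weight-↭ ↭refl        = refl
  weight-↭ (prep x p)   = *-congˡ (weight-↭ p)
  weight-↭ (swap x y p) = trans (*-congˡ (*-congˡ (weight-↭ p)))
    (solve 3 (λ a b c → a :* (b :* c) := b :* (a :* c)) refl _ _ _)
  weight-↭ (↭trans p r) = trans (weight-↭ p) (weight-↭ r)

  weight-++ : ∀ u v → weight (u ++ v) ≈ weight u * weight v
  weight-++ []      v = sym (*-identityˡ _)
  weight-++ (x ∷ u) v = trans (*-congˡ (weight-++ u v)) (sym (*-assoc _ _ _))

  -- suffixCoeff is the coefficient of e_n at σ, rewritten through the suffix products S_j = P_j⁻¹: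
  -- P_j / (1 − P_j) = 1 / (S_j − 1)  and  1 / (1 − P_j) = S_j / (S_j − 1).
  suffixCoeff′ : Fin n → List (Fin n) → Carrier
  suffixCoeff′ x []      = 1#
  suffixCoeff′ x (a ∷ w) =
    (x ≺ a) ⟨ weight (a ∷ w) ⟩ * (weight (a ∷ w) - 1#) ⁻¹ * suffixCoeff′ a w

  suffixCoeff : List (Fin n) → Carrier
  suffixCoeff []      = 1#
  suffixCoeff (a ∷ w) = suffixCoeff′ a w

  -- This keeps every factor S - 1 invertible. Since v may be empty, l itself is included; when the
  -- total weight is 1, the condition can only be asked of words that lack a letter.
  NonResonant : List (Fin n) → Set ℓ
  NonResonant l = ∀ x u v → (x ∷ u) ++ v ↭ l → ¬ (weight (x ∷ u) ≈ 1#)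

  nonResonant-∷ : ∀ {a l} → NonResonant (a ∷ l) → NonResonant l
  nonResonant-∷ {a} nr x u v p =
    nr x u (a ∷ v) (↭-trans (shift a (x ∷ u) v) (prep a p))

  nonResonant-↭ : ∀ {l l′} → l ↭ l′ → NonResonant l → NonResonant l′
  nonResonant-↭ p nr x u v p′ = nr x u v (↭-trans p′ (↭-sym p))

  minus-inverse : ∀ {s} → ¬ (s ≈ 1#) → (s - 1#) * (s - 1#) ⁻¹ ≈ 1#
  minus-inverse s≉1 = inverseʳ _ (s≉1 ∘ x∙y⁻¹≈ε⇒x≈y _ _)

  1+minus : ∀ s → 1# + (s - 1#) ≈ s
  1+minus s = begin
    1# + (s - 1#)     ≈⟨ +-comm _ _ ⟩
    (s - 1#) + 1#     ≈⟨ +-assoc _ _ _ ⟩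
    s + (- 1# + 1#)   ≈⟨ +-congˡ (-‿inverseˡ _) ⟩
    s + 0#            ≈⟨ +-identityʳ _ ⟩
    s                 ∎

  -- Adding 1 turns both sides into U V, which leaves semiring arithmetic with U - 1 and V - 1 as
  -- atoms.
  minus-* : ∀ U V → V * (U - 1#) + (V - 1#) ≈ U * V - 1#
  minus-* U V = +-cancelˡ 1# _ _ (begin
    1# + (V * (U - 1#) + (V - 1#))
      ≈⟨ solve 3 (λ V u v → con 1 :+ (V :* u :+ v) := V :* u :+ (con 1 :+ v)) refl _ _ _ ⟩
    V * (U - 1#) + (1# + (V - 1#))  ≈⟨ +-congˡ (1+minus V) ⟩
    V * (U - 1#) + V
      ≈⟨ solve 2 (λ V u → V :* u :+ V := (con 1 :+ u) :* V) refl _ _ ⟩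
    (1# + (U - 1#)) * V             ≈⟨ *-congʳ (1+minus U) ⟩
    U * V                           ≈⟨ 1+minus (U * V) ⟨
    1# + (U * V - 1#)               ∎)

  -- The case a < b of `≺-exchange`, with p for x ≺ a and p′ for x ≺ b. The implication excludes the
  -- combination true, false, for which the identity fails in general.
  exchange : ∀ p p′ → (p ≡ true → p′ ≡ true) → ∀ U V →
    p ⟨ U * V ⟩ * V * (U - 1#) + p′ ⟨ U * V ⟩ * (V - 1#)
      ≈ p ⟨ U ⟩ * p′ ⟨ V ⟩ * (U * V - 1#)
  exchange true  false imp U V with () ← imp ≡.refl
  exchange true  true  imp U V = trans
    (solve 4 (λ U V u v → U :* V :* V :* u :+ U :* V :* v := U :* V :* (V :* u :+ v))
      refl U V (U - 1#) (V - 1#))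
    (*-congˡ (minus-* U V))
  exchange false true  imp U V = begin
    1# * V * (U - 1#) + U * V * (V - 1#)
      ≈⟨ solve 4 (λ U V u v → con 1 :* V :* u :+ U :* V :* v := con 1 :* V :* (U :* v :+ u))
           refl U V (U - 1#) (V - 1#) ⟩
    1# * V * (U * (V - 1#) + (U - 1#))  ≈⟨ *-congˡ (minus-* V U) ⟩
    1# * V * (V * U - 1#)               ≈⟨ *-congˡ (+-congʳ (*-comm V U)) ⟩
    1# * V * (U * V - 1#)               ∎
  exchange false false imp U V = trans
    (solve 3 (λ V u v → con 1 :* V :* u :+ con 1 :* v := con 1 :* con 1 :* (V :* u :+ v))
      refl V (U - 1#) (V - 1#))
    (*-congˡ (minus-* U V))

  <⇒≺ : ∀ {a b : Fin n} → toℕ a ℕ.< toℕ b → (a ≺ b) ≡ true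
  <⇒≺ {a} {b} a<b with toℕ a ℕ.<ᵇ toℕ b | ℕ.<⇒<ᵇ a<b
  ... | true | _ = ≡.refl

  ≤⇒⊀ : ∀ {a b : Fin n} → toℕ b ℕ.≤ toℕ a → (a ≺ b) ≡ false
  ≤⇒⊀ {a} {b} b≤a with toℕ a ℕ.<ᵇ toℕ b in eq
  ... | false = ≡.refl
  ... | true  = contradiction (ℕ.<ᵇ⇒< _ _ (≡.subst T (≡.sym eq) _)) (ℕ.≤⇒≯ b≤a)

  ≺-trans-< : ∀ {x a b : Fin n} → toℕ a ℕ.< toℕ b → (x ≺ a) ≡ true → (x ≺ b) ≡ true
  ≺-trans-< {x} {a} a<b x≺a =
    <⇒≺ (ℕ.<-trans (ℕ.<ᵇ⇒< (toℕ x) (toℕ a) (≡.subst T (≡.sym x≺a) _)) a<b)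

  -- The identity behind multiplicativity, denominators cleared: a shuffle starts with a or with b,
  -- and the two contributions add up to a product. The case b < a follows from a < b by symmetry.
  ≺-exchange : ∀ x a b → a ≢ b → ∀ U V →
    (x ≺ a) ⟨ U * V ⟩ * (a ≺ b) ⟨ V ⟩ * (U - 1#) + (x ≺ b) ⟨ U * V ⟩ * (b ≺ a) ⟨ U ⟩ * (V - 1#)
      ≈ (x ≺ a) ⟨ U ⟩ * (x ≺ b) ⟨ V ⟩ * (U * V - 1#)
  ≺-exchange x a b a≢b U V with ℕ.<-cmp (toℕ a) (toℕ b)
  ... | tri≈ _ a≡b _ = contradiction (Fin.toℕ-injective a≡b) a≢b
  ... | tri< a<b _ _ rewrite <⇒≺ {a} {b} a<b | ≤⇒⊀ {b} {a} (ℕ.<⇒≤ a<b) =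
    trans (+-congˡ (*-congʳ (*-identityʳ _)))
      (exchange (x ≺ a) (x ≺ b) (≺-trans-< {x} a<b) U V)
  ... | tri> _ _ b<a rewrite <⇒≺ {b} {a} b<a | ≤⇒⊀ {a} {b} (ℕ.<⇒≤ b<a) = begin
    (x ≺ a) ⟨ U * V ⟩ * 1# * (U - 1#) + (x ≺ b) ⟨ U * V ⟩ * U * (V - 1#)
      ≈⟨ trans (+-comm _ _) (+-cong
           (*-congʳ (*-congʳ (⟨⟩-cong (x ≺ b) (*-comm U V))))
           (*-congʳ (trans (*-identityʳ _) (⟨⟩-cong (x ≺ a) (*-comm U V))))) ⟩
    (x ≺ b) ⟨ V * U ⟩ * U * (V - 1#) + (x ≺ a) ⟨ V * U ⟩ * (U - 1#)
      ≈⟨ exchange (x ≺ b) (x ≺ a) (≺-trans-< {x} b<a) V U ⟩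
    (x ≺ b) ⟨ V ⟩ * (x ≺ a) ⟨ U ⟩ * (V * U - 1#)
      ≈⟨ *-cong (*-comm _ _) (+-congʳ (*-comm V U)) ⟩
    (x ≺ a) ⟨ U ⟩ * (x ≺ b) ⟨ V ⟩ * (U * V - 1#)
      ∎

  -- Split by the first letter of the shuffle. All shuffles have weight U V, so the first factor
  -- depends on that letter only; the tail is multiplicative by induction, with that letter as the
  -- new x.
  shuffleSum-suffixCoeff′ : ∀ x u v → NonResonant (u ++ v) → Disjoint u v →
    shuffleSum u v (suffixCoeff′ x) ≈ suffixCoeff′ x u * suffixCoeff′ x v
  shuffleSum-suffixCoeff′ x []      v       nr dis = sym (*-identityˡ _)
  shuffleSum-suffixCoeff′ x (a ∷ u) []      nr dis = sym (*-identityʳ _)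
  shuffleSum-suffixCoeff′ x (a ∷ u) (b ∷ v) nr dis = begin
    shuffleSum u (b ∷ v) (suffixCoeff′ x ∘ (a ∷_)) + shuffleSum (a ∷ u) v (suffixCoeff′ x ∘ (b ∷_))
      ≈⟨ +-cong
           (peel a u (b ∷ v) refl
             (shuffleSum-suffixCoeff′ a u (b ∷ v) (nonResonant-∷ nr) (λ (i , j) → dis (there i , j))))
           (peel b (a ∷ u) v (weight-↭ (↭-sym (shift b (a ∷ u) v)))
             (shuffleSum-suffixCoeff′ b (a ∷ u) v
               (nonResonant-∷ (nonResonant-↭ (shift b (a ∷ u) v) nr))
               (λ (i , j) → dis (i , there j)))) ⟩
    (x ≺ a) ⟨ U * V ⟩ * d⁻¹ * (Ha * ((a ≺ b) ⟨ V ⟩ * v⁻¹ * Hb))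
      + (x ≺ b) ⟨ U * V ⟩ * d⁻¹ * ((b ≺ a) ⟨ U ⟩ * u⁻¹ * Ha * Hb)
      -- Both terms are expanded by a factor equal to 1 to reach the common denominator.
      ≈⟨ +-cong (sym (trans (*-congʳ uu⁻¹) (*-identityˡ _)))
                (sym (trans (*-congʳ vv⁻¹) (*-identityˡ _))) ⟩
    (U - 1#) * u⁻¹ * ((x ≺ a) ⟨ U * V ⟩ * d⁻¹ * (Ha * ((a ≺ b) ⟨ V ⟩ * v⁻¹ * Hb)))
      + (V - 1#) * v⁻¹ * ((x ≺ b) ⟨ U * V ⟩ * d⁻¹ * ((b ≺ a) ⟨ U ⟩ * u⁻¹ * Ha * Hb))
      ≈⟨ solve 11 (λ xa ab xb ba u v u⁻¹ v⁻¹ d⁻¹ Ha Hb →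
             u :* u⁻¹ :* (xa :* d⁻¹ :* (Ha :* (ab :* v⁻¹ :* Hb)))
               :+ v :* v⁻¹ :* (xb :* d⁻¹ :* (ba :* u⁻¹ :* Ha :* Hb))
             := (xa :* ab :* u :+ xb :* ba :* v) :* (d⁻¹ :* (u⁻¹ :* v⁻¹ :* (Ha :* Hb))))
           refl _ _ _ _ _ _ _ _ _ _ _ ⟩
    ((x ≺ a) ⟨ U * V ⟩ * (a ≺ b) ⟨ V ⟩ * (U - 1#) + (x ≺ b) ⟨ U * V ⟩ * (b ≺ a) ⟨ U ⟩ * (V - 1#))
      * (d⁻¹ * (u⁻¹ * v⁻¹ * (Ha * Hb)))
      ≈⟨ *-congʳ (≺-exchange x a b (λ { ≡.refl → dis (here ≡.refl , here ≡.refl) }) U V) ⟩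
    ((x ≺ a) ⟨ U ⟩ * (x ≺ b) ⟨ V ⟩ * (U * V - 1#)) * (d⁻¹ * (u⁻¹ * v⁻¹ * (Ha * Hb)))
      ≈⟨ solve 8 (λ xa xb d d⁻¹ u⁻¹ v⁻¹ Ha Hb →
             (xa :* xb :* d) :* (d⁻¹ :* (u⁻¹ :* v⁻¹ :* (Ha :* Hb)))
             := (d :* d⁻¹) :* (xa :* u⁻¹ :* Ha :* (xb :* v⁻¹ :* Hb)))
           refl _ _ _ _ _ _ _ _ ⟩
    ((U * V - 1#) * d⁻¹) * ((x ≺ a) ⟨ U ⟩ * u⁻¹ * Ha * ((x ≺ b) ⟨ V ⟩ * v⁻¹ * Hb))
      ≈⟨ trans (*-congʳ dd⁻¹) (*-identityˡ _) ⟩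
    (x ≺ a) ⟨ U ⟩ * u⁻¹ * Ha * ((x ≺ b) ⟨ V ⟩ * v⁻¹ * Hb)
      ∎
    where
    U = weight (a ∷ u)
    V = weight (b ∷ v)
    u⁻¹ = (U - 1#) ⁻¹
    v⁻¹ = (V - 1#) ⁻¹
    d⁻¹ = (U * V - 1#) ⁻¹
    Ha = suffixCoeff′ a u
    Hb = suffixCoeff′ b v
    uu⁻¹ : (U - 1#) * u⁻¹ ≈ 1#
    uu⁻¹ = minus-inverse (nr a u (b ∷ v) ↭-refl)
    vv⁻¹ : (V - 1#) * v⁻¹ ≈ 1#
    vv⁻¹ = minus-inverse (nr b v (a ∷ u) (++-comm (b ∷ v) (a ∷ u)))
    dd⁻¹ : (U * V - 1#) * d⁻¹ ≈ 1#
    dd⁻¹ = minus-inverse λ e →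
      nr a (u ++ b ∷ v) [] (++-comm ((a ∷ u) ++ b ∷ v) []) (trans (weight-++ (a ∷ u) (b ∷ v)) e)
    -- Each word c ∷ y in the sum has weight U V, so the factor at the cut between x and c is
    -- constant and comes out.
    peel : ∀ c w z {h} → weight (c ∷ w ++ z) ≈ weight ((a ∷ u) ++ b ∷ v) →
      shuffleSum w z (suffixCoeff′ c) ≈ h →
      shuffleSum w z (suffixCoeff′ x ∘ (c ∷_)) ≈ (x ≺ c) ⟨ U * V ⟩ * d⁻¹ * h
    peel c w z eq ih = trans
      (trans (shuffleSum-cong w z (λ y p →
          let e = trans (weight-↭ (prep c p)) (trans eq (weight-++ (a ∷ u) (b ∷ v)))
          in *-congʳ (*-cong (⟨⟩-cong (x ≺ c) e) (⁻¹-cong (+-congʳ e)))))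
        (shuffleSum-scale _ w z _))
      (*-congˡ ih)

  -- Behind the first letter both sums are products by multiplicativity. They cancel because the
  -- right side of `≺-exchange` contains U V - 1, which is 0 here.
  shuffleSum-suffixCoeff : ∀ {a b} u v →
    NonResonant (u ++ b ∷ v) → NonResonant (a ∷ u ++ v) → Disjoint (a ∷ u) (b ∷ v) →
    weight (a ∷ u) * weight (b ∷ v) ≈ 1# →
    shuffleSum (a ∷ u) (b ∷ v) suffixCoeff ≈ 0#
  shuffleSum-suffixCoeff {a} {b} u v nr nr′ dis UV≈1 = begin
    shuffleSum u (b ∷ v) (suffixCoeff′ a) + shuffleSum (a ∷ u) v (suffixCoeff′ b)
      ≈⟨ +-cong (shuffleSum-suffixCoeff′ a u (b ∷ v) nr (λ (i , j) → dis (there i , j)))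
                (shuffleSum-suffixCoeff′ b (a ∷ u) v nr′ (λ (i , j) → dis (i , there j))) ⟩
    Ha * ((a ≺ b) ⟨ V ⟩ * v⁻¹ * Hb) + (b ≺ a) ⟨ U ⟩ * u⁻¹ * Ha * Hb
      ≈⟨ +-cong (sym (trans (*-congʳ uu⁻¹) (*-identityˡ _)))
                (sym (trans (*-congʳ vv⁻¹) (*-identityˡ _))) ⟩
    (U - 1#) * u⁻¹ * (Ha * ((a ≺ b) ⟨ V ⟩ * v⁻¹ * Hb))
      + (V - 1#) * v⁻¹ * ((b ≺ a) ⟨ U ⟩ * u⁻¹ * Ha * Hb)
      ≈⟨ solve 8 (λ ab ba u v u⁻¹ v⁻¹ Ha Hb →
             u :* u⁻¹ :* (Ha :* (ab :* v⁻¹ :* Hb)) :+ v :* v⁻¹ :* (ba :* u⁻¹ :* Ha :* Hb)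
             := (con 1 :* ab :* u :+ con 1 :* ba :* v) :* (u⁻¹ :* v⁻¹ :* (Ha :* Hb)))
           refl _ _ _ _ _ _ _ _ ⟩
    (1# * (a ≺ b) ⟨ V ⟩ * (U - 1#) + 1# * (b ≺ a) ⟨ U ⟩ * (V - 1#)) * (u⁻¹ * v⁻¹ * (Ha * Hb))
      -- The front cut absent from `suffixCoeff` can be supplied with any x, here a, since its
      -- factor is U V or 1 and U V = 1.
      ≈⟨ *-congʳ (trans (+-cong (*-congʳ (*-congʳ (one (a ≺ a)))) (*-congʳ (*-congʳ (one (a ≺ b)))))
           (trans (≺-exchange a a b (λ { ≡.refl → dis (here ≡.refl , here ≡.refl) }) U V)
             (trans (*-congˡ (trans (+-congʳ UV≈1) (-‿inverseʳ 1#))) (zeroʳ _)))) ⟩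
    0# * (u⁻¹ * v⁻¹ * (Ha * Hb))
      ≈⟨ zeroˡ _ ⟩
    0#
      ∎
    where
    U = weight (a ∷ u)
    V = weight (b ∷ v)
    u⁻¹ = (U - 1#) ⁻¹
    v⁻¹ = (V - 1#) ⁻¹
    Ha = suffixCoeff′ a u
    Hb = suffixCoeff′ b v
    uu⁻¹ : (U - 1#) * u⁻¹ ≈ 1#
    uu⁻¹ = minus-inverse (nr′ a u v ↭-refl)
    vv⁻¹ : (V - 1#) * v⁻¹ ≈ 1#
    vv⁻¹ = minus-inverse (nr b v u (++-comm (b ∷ v) u))
    one : ∀ p → 1# ≈ p ⟨ U * V ⟩
    one true  = sym UV≈1
    one false = refl

  -- Products over cuts, and the sum over σ.

  cutProduct : (Fin n → Fin n → Bool) → Carrier → List (Fin n) → Carrier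
  cutProduct R p []          = 1#
  cutProduct R p (a ∷ [])    = 1#
  -- Here p is the product of the letters already read, so p * q a is the prefix product P_j. R
  -- selects the cuts: descents of the word, or pairs reversed in σ.
  cutProduct R p (a ∷ b ∷ l) = R a b ⟨ p * q a ⟩ * cutProduct R (p * q a) (b ∷ l)

  cutProduct-insert : ∀ {t} α β p l → t ∉ l →
    cutProduct (λ a b → precedes Fin._≟_ (α ++ t ∷ β) b a) p l
      ≡ cutProduct (λ a b → precedes Fin._≟_ (α ++ β) b a) p l
  cutProduct-insert α β p []          t∉ = ≡.refl
  cutProduct-insert α β p (a ∷ [])    t∉ = ≡.refl
  cutProduct-insert α β p (a ∷ b ∷ l) t∉ = ≡.cong₂ (λ c z → c ⟨ p * q a ⟩ * z)
    (precedes-insert Fin._≟_ (t∉ ∘ there ∘ here) (t∉ ∘ here) α β)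
    (cutProduct-insert α β (p * q a) (b ∷ l) (t∉ ∘ there))

  module _ {l : List (Fin n)} (weight≈1 : weight l ≈ 1#) (uniq : Unique l)
    -- The letter y keeps the complement nonempty, as the whole of l has weight 1.
    (nr : ∀ x u y v → (x ∷ u) ++ y ∷ v ↭ l → ¬ (weight (x ∷ u) ≈ 1#)) where

    -- The words t ∷ r and w are nonempty and complementary in l, so their weights multiply to 1.
    -- Without t or b, only proper parts of l remain, and those are non-resonant.
    shuffleSum-vanishes : ∀ {t t′} r rest w → (t ∷ t′ ∷ rest) ++ r ↭ l → w ↭ t′ ∷ rest →
      shuffleSum (t ∷ r) w suffixCoeff ≈ 0#
    shuffleSum-vanishes r rest [] p w↭ = contradiction (↭-sym w↭) ¬x∷xs↭[]
    shuffleSum-vanishes {t} {t′} r rest (b ∷ w) p w↭ = shuffleSum-suffixCoeff r w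
      (λ x u v e → nr x u t v (↭-trans (shift t (x ∷ u) v) (↭-trans (prep t e) p′)))
      (λ x u v e → nr x u b v (↭-trans (shift b (x ∷ u) v)
        (↭-trans (prep b e) (↭-trans (↭-sym (shift b (t ∷ r) w)) p′))))
      (++⇒disjoint (t ∷ r) (Unique-resp-↭ (≡.setoid (Fin n)) (↭⇒↭ₛ (↭-sym p′)) uniq))
      (trans (sym (weight-++ (t ∷ r) (b ∷ w))) (trans (weight-↭ p′) weight≈1))
      where
      p′ : (t ∷ r) ++ b ∷ w ↭ l
      p′ = ↭-trans (prep t (↭-trans (++⁺ˡ r w↭) (++-comm r (t′ ∷ rest)))) p

    -- r holds the letters already forced to follow t, so that p * q t = weight (t ∷ r) is P_j.
    permSum-shuffleAfter : ∀ t r rest p → p ≈ weight r → (t ∷ rest) ++ r ↭ l →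
      permSum (t ∷ rest) (λ σ →
        cutProduct (λ a b → precedes Fin._≟_ σ b a) p (t ∷ rest)
          * shuffleAfter Fin._≟_ t r σ suffixCoeff)
        ≈ suffixCoeff (t ∷ r) * cutProduct (λ a b → b ≺ a) p (t ∷ rest)
    permSum-shuffleAfter t r [] p p≈ perm
      rewrite dec-true (t Fin.≟ t) ≡.refl | shuffleSum-[] r (suffixCoeff ∘ (t ∷_)) =
      *-comm _ _
    permSum-shuffleAfter t r (t′ ∷ rest) p p≈ perm = begin
      permSum (t′ ∷ rest) (λ w → insertSum t w (λ σ → precedes Fin._≟_ σ t′ t ⟨ P ⟩ * cp σ * sA σ))
        -- The letter t is inserted last. Only the words with t behind t′ survive, with a factor P -
        -- 1, and r grows to t ∷ r.
        ≈⟨ permSum-cong (t′ ∷ rest) step ⟩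
      permSum (t′ ∷ rest) (λ w → (P - 1#) * (cp w * sA′ w))
        ≈⟨ permSum-scale (P - 1#) (t′ ∷ rest) _ ⟩
      (P - 1#) * permSum (t′ ∷ rest) (λ w → cp w * sA′ w)
        ≈⟨ *-congˡ (permSum-shuffleAfter t′ (t ∷ r) rest P P≈ perm′) ⟩
      (P - 1#) * (suffixCoeff (t′ ∷ t ∷ r) * N)
        -- The first cut of t′ ∷ t ∷ r has suffix weight P: its denominator cancels P - 1, and its
        -- numerator is the descent factor of τ at the pair t, t′.
        ≈⟨ *-congˡ (*-congʳ (*-congʳ (*-cong (⟨⟩-cong (t′ ≺ t) (sym P≈)) (⁻¹-cong (+-congʳ (sym P≈)))))) ⟩
      (P - 1#) * ((t′ ≺ t) ⟨ P ⟩ * (P - 1#) ⁻¹ * suffixCoeff′ t r * N)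
        ≈⟨ solve 5 (λ d d⁻¹ p h n → d :* (p :* d⁻¹ :* h :* n) := d :* d⁻¹ :* (h :* (p :* n)))
             refl _ _ _ _ _ ⟩
      (P - 1#) * (P - 1#) ⁻¹ * (suffixCoeff′ t r * ((t′ ≺ t) ⟨ P ⟩ * N))
        ≈⟨ trans (*-congʳ (minus-inverse P≉1)) (*-identityˡ _) ⟩
      suffixCoeff′ t r * ((t′ ≺ t) ⟨ P ⟩ * N)
        ∎
      where
      P = p * q t
      N = cutProduct (λ a b → b ≺ a) P (t′ ∷ rest)
      cp sA sA′ : List (Fin n) → Carrier
      cp σ = cutProduct (λ a b → precedes Fin._≟_ σ b a) P (t′ ∷ rest)
      sA σ = shuffleAfter Fin._≟_ t r σ suffixCoeff
      sA′ w = shuffleAfter Fin._≟_ t′ (t ∷ r) w suffixCoeff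
      P≈ : P ≈ weight (t ∷ r)
      P≈ = trans (*-comm _ _) (*-congˡ p≈)
      perm′ : (t′ ∷ rest) ++ t ∷ r ↭ l
      perm′ = ↭-trans (shift t (t′ ∷ rest) r) perm
      P≉1 : ¬ (P ≈ 1#)
      P≉1 e = nr t r t′ rest (↭-trans (++-comm (t ∷ r) (t′ ∷ rest)) perm′) (trans (sym P≈) e)
      t∉ : t ∉ t′ ∷ rest
      t∉ i = ++⇒disjoint (t′ ∷ rest) (Unique-resp-↭ (≡.setoid (Fin n)) (↭⇒↭ₛ (↭-sym perm′)) uniq) (i , here ≡.refl)
      split : ∀ b c s → b ⟨ P ⟩ * c * s ≈ c * (s + (P - 1#) * (if b then s else 0#))
      split true c s = begin
        P * c * s                        ≈⟨ *-congʳ (*-congʳ (1+minus P)) ⟨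
        (1# + (P - 1#)) * c * s
          ≈⟨ solve 3 (λ d c s → (con 1 :+ d) :* c :* s := c :* (s :+ d :* s)) refl _ _ _ ⟩
        c * (s + (P - 1#) * s)           ∎
      split false c s =
        solve 3 (λ d c s → con 1 :* c :* s := c :* (s :+ d :* con 0)) refl _ _ _
      step : ∀ w → w ↭ t′ ∷ rest →
        insertSum t w (λ σ → precedes Fin._≟_ σ t′ t ⟨ P ⟩ * cp σ * sA σ)
          ≈ (P - 1#) * (cp w * sA′ w)
      step w w↭ = begin
        insertSum t w (λ σ → precedes Fin._≟_ σ t′ t ⟨ P ⟩ * cp σ * sA σ)
          ≈⟨ insertSum-cong t w (λ σ _ → split (precedes Fin._≟_ σ t′ t) (cp σ) (sA σ)) ⟩
        insertSum t w (λ σ → cp σ * (sA σ + (P - 1#) * (if precedes Fin._≟_ σ t′ t then sA σ else 0#)))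
          ≈⟨ insertSum-scale t w cp _ (λ α β → reflexive (cutProduct-insert α β P (t′ ∷ rest) t∉)) ⟩
        cp w * insertSum t w (λ σ → sA σ + (P - 1#) * (if precedes Fin._≟_ σ t′ t then sA σ else 0#))
          -- The summand 1 yields a full shuffle sum, which vanishes; the summand P - 1 confines t
          -- to the places behind t′.
          ≈⟨ *-congˡ (trans (insertSum-+ t w _ _) (+-cong
               (trans (insertSum-shuffleAfter Fin._≟_ t r w suffixCoeff t∉w)
                      (shuffleSum-vanishes r rest w perm w↭))
               (trans (insertSum-scale t w (λ _ → P - 1#) _ (λ _ _ → refl))
                 (*-congˡ (insertSum-shuffleAfter-precedes Fin._≟_ t t′ r w suffixCoeff
                   (t∉ ∘ here) t∉w))))) ⟩
        cp w * (0# + (P - 1#) * sA′ w)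
          ≈⟨ solve 3 (λ c d s → c :* (con 0 :+ d :* s) := d :* (c :* s)) refl _ _ _ ⟩
        (P - 1#) * (cp w * sA′ w)
          ∎
        where
        t∉w : t ∉ w
        t∉w i = t∉ (∈-resp-↭ w↭ i)

  -- From suffix products back to prefix products.

  cutDenom : Carrier → List (Fin n) → Carrier
  cutDenom p []          = 1#
  cutDenom p (a ∷ [])    = 1#
  cutDenom p (a ∷ b ∷ l) = (1# - p * q a) * cutDenom (p * q a) (b ∷ l)

  -- One cut: S (1 - P) = S - 1 at an ascent, and 1 - P = P (S - 1) at a descent.
  suffixFactor : ∀ {a b} → a ≢ b → ∀ {P S} → P * S ≈ 1# → ¬ (S ≈ 1#) →
    (a ≺ b) ⟨ S ⟩ * (S - 1#) ⁻¹ * (1# - P) ≈ (b ≺ a) ⟨ P ⟩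
  suffixFactor {a} {b} a≢b {P} {S} PS≈1 S≉1 with ℕ.<-cmp (toℕ a) (toℕ b)
  ... | tri≈ _ a≡b _ = contradiction (Fin.toℕ-injective a≡b) a≢b
  ... | tri< a<b _ _ rewrite <⇒≺ {a} {b} a<b | ≤⇒⊀ {b} {a} (ℕ.<⇒≤ a<b) = begin
    S * (S - 1#) ⁻¹ * (1# - P)
      ≈⟨ solve 3 (λ s i d → s :* i :* d := (s :* d) :* i) refl _ _ _ ⟩
    S * (1# - P) * (S - 1#) ⁻¹
      ≈⟨ *-congʳ (trans (x[y-z]≈xy-xz S 1# P)
           (+-cong (*-identityʳ S) (-‿cong (trans (*-comm S P) PS≈1)))) ⟩
    (S - 1#) * (S - 1#) ⁻¹
      ≈⟨ minus-inverse S≉1 ⟩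
    1#
      ∎
  ... | tri> _ _ b<a rewrite <⇒≺ {b} {a} b<a | ≤⇒⊀ {a} {b} (ℕ.<⇒≤ b<a) = begin
    1# * (S - 1#) ⁻¹ * (1# - P)
      ≈⟨ *-congˡ (sym (trans (x[y-z]≈xy-xz P S 1#)
           (+-cong PS≈1 (-‿cong (*-identityʳ P))))) ⟩
    1# * (S - 1#) ⁻¹ * (P * (S - 1#))
      ≈⟨ solve 3 (λ i p d → con 1 :* i :* (p :* d) := (d :* i) :* p) refl _ _ _ ⟩
    (S - 1#) * (S - 1#) ⁻¹ * P
      ≈⟨ trans (*-congʳ (minus-inverse S≉1)) (*-identityˡ _) ⟩
    P
      ∎

  -- Cut by cut through `suffixFactor`; p times the weight of the remaining word stays 1 as letters
  -- pass from the suffix to the prefix.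
  suffixCoeff-cutDenom : ∀ a w p → Unique (a ∷ w) → NonResonant w → p * weight (a ∷ w) ≈ 1# →
    suffixCoeff (a ∷ w) * cutDenom p (a ∷ w) ≈ cutProduct (λ a b → b ≺ a) p (a ∷ w)
  suffixCoeff-cutDenom a []      p uniq nr pS≈1 = *-identityˡ _
  suffixCoeff-cutDenom a (b ∷ w) p ((a≢b ∷ _) ∷ uniq) nr pS≈1 = begin
    (a ≺ b) ⟨ S ⟩ * (S - 1#) ⁻¹ * suffixCoeff (b ∷ w) * ((1# - P) * cutDenom P (b ∷ w))
      ≈⟨ solve 4 (λ k c d e → k :* c :* (d :* e) := (k :* d) :* (c :* e)) refl _ _ _ _ ⟩
    (a ≺ b) ⟨ S ⟩ * (S - 1#) ⁻¹ * (1# - P) * (suffixCoeff (b ∷ w) * cutDenom P (b ∷ w))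
      ≈⟨ *-cong
           (suffixFactor a≢b PS≈1 (nr b w [] (++-comm (b ∷ w) [])))
           (suffixCoeff-cutDenom b w P uniq (nonResonant-∷ nr) PS≈1) ⟩
    (b ≺ a) ⟨ P ⟩ * cutProduct (λ a b → b ≺ a) P (b ∷ w)
      ∎
    where
    P = p * q a
    S = weight (b ∷ w)
    PS≈1 : P * S ≈ 1#
    PS≈1 = trans (*-assoc _ _ _) pS≈1

-- The enumeration of permutations as words.

toList-injective : ∀ {a} {A : Set a} {n} {u v : Vec A n} → toList u ≡ toList v → u ≡ v
toList-injective {u = u} {v} e =
  ≡.trans (≡.sym (Vec.cast-is-id ≡.refl u)) (Vec.toList-injective ≡.refl u v e)

map-lookup-allFin : ∀ {a} {A : Set a} {n} (v : Vec A n) → map (lookup v) (allFin n) ≡ toList v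
map-lookup-allFin {n = n} v = ≡.trans (map-tabulate (λ i → i) (lookup v)) (tabulate-lookup v)
  where
  tabulate-lookup : ∀ {n} (v : Vec _ n) → tabulate (lookup v) ≡ toList v
  tabulate-lookup Vec.[]       = ≡.refl
  tabulate-lookup (x Vec.∷ v) = ≡.cong (x ∷_) (tabulate-lookup v)

allFin-suc : ∀ n → allFin (suc n) ≡ Fin.zero ∷ map Fin.suc (allFin n)
allFin-suc n = ≡.cong (Fin.zero ∷_) (≡.sym (map-tabulate (λ i → i) Fin.suc))

insertAll-↭ : ∀ {a} {A : Set a} {n} x (v : Vec A n) {σ} → σ ∈ insertAll x v → toList σ ↭ x ∷ toList v
insertAll-↭ x Vec.[]      (here ≡.refl) = ↭-refl
insertAll-↭ x (y Vec.∷ v) (here ≡.refl) = ↭-refl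
insertAll-↭ x (y Vec.∷ v) (there σ∈) with _ , ρ∈ , ≡.refl ← ∈-map⁻ (y Vec.∷_) σ∈ =
  ↭-trans (prep y (insertAll-↭ x v ρ∈)) (swap y x ↭-refl)

insertAll-complete : ∀ {a} {A : Set a} {n} x (v : Vec A n) α {β} → toList v ≡ α ++ β →
  ∃[ σ ] σ ∈ insertAll x v × toList σ ≡ α ++ x ∷ β
insertAll-complete x Vec.[]      []      ≡.refl = _ , here ≡.refl , ≡.refl
insertAll-complete x (y Vec.∷ v) []      ≡.refl = _ , here ≡.refl , ≡.refl
insertAll-complete x (y Vec.∷ v) (_ ∷ α) e
  with ≡.refl , e′ ← ∷-injective e
  with _ , σ∈ , eq ← insertAll-complete x v α e′ =
  _ , there (∈-map⁺ (y Vec.∷_) σ∈) , ≡.cong (y ∷_) eq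

perms-↭ : ∀ n {σ} → σ ∈ perms n → toList σ ↭ allFin n
perms-↭ zero    (here ≡.refl) = ↭-refl
perms-↭ (suc n) σ∈
  with v , v∈ , σ∈′ ← find (∈-concatMap⁻ (λ v → insertAll Fin.zero (Vec.map Fin.suc v)) {xs = perms n} σ∈) =
  ↭-trans (insertAll-↭ Fin.zero (Vec.map Fin.suc v) σ∈′)
    (↭-trans (↭-reflexive (≡.cong (Fin.zero ∷_) (Vec.toList-map Fin.suc v)))
      (↭-trans (prep Fin.zero (map⁺ Fin.suc (perms-↭ n v∈)))
        (↭-reflexive (≡.sym (allFin-suc n)))))

-- Remove 0 from l and lower the other letters to get a word of `perms n`; inserting 0 again behind
-- α restores l.
perms-complete : ∀ n {l} → l ↭ allFin n → ∃[ σ ] σ ∈ perms n × toList σ ≡ l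
perms-complete zero    l↭ with ≡.refl ← ↭-empty-inv l↭ = _ , here ≡.refl , ≡.refl
perms-complete (suc n) l↭
  with l↭′ ← ↭-trans l↭ (↭-reflexive (allFin-suc n))
  with α , β , ≡.refl ← ∈-∃++ (∈-resp-↭ (↭-sym l↭′) (here ≡.refl))
  with l′ , e , p ← ↭-map-inv Fin.suc (↭-sym (drop-mid α [] l↭′))
  with v , v∈ , ≡.refl ← perms-complete n (↭-sym p)
  with σ , σ∈ , eq ← insertAll-complete Fin.zero (Vec.map Fin.suc v) α
         (≡.trans (Vec.toList-map Fin.suc v) (≡.sym e)) =
  σ , ∈-concatMap⁺ (λ v → insertAll Fin.zero (Vec.map Fin.suc v)) (lose v∈ σ∈) , eq

perms-unique : ∀ {n} {σ : Perm n} → σ ∈ perms n → Unique (toList σ)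
perms-unique {n} σ∈ =
  Unique-resp-↭ (≡.setoid (Fin n)) (↭⇒↭ₛ (↭-sym (perms-↭ n σ∈))) (allFin⁺ n)

-- Sums over lists as sums over words.

module ListSums {c ℓ} (L : Field c ℓ) where
  open Field L
  open Twisted L using (sumL)
  open WordSums L

  module _ {a} {A : Set a} where

    sumL-cong : ∀ (xs : List A) {f g : A → Carrier} →
      (∀ x → x ∈ xs → f x ≈ g x) → sumL (map f xs) ≈ sumL (map g xs)
    sumL-cong []       h = refl
    sumL-cong (x ∷ xs) h = +-cong (h x (here ≡.refl)) (sumL-cong xs (λ y y∈ → h y (there y∈)))

    sumL-++ : ∀ (f : A → Carrier) xs ys →
      sumL (map f (xs ++ ys)) ≈ sumL (map f xs) + sumL (map f ys)
    sumL-++ f []       ys = sym (+-identityˡ _)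
    sumL-++ f (x ∷ xs) ys = trans (+-congˡ (sumL-++ f xs ys)) (sym (+-assoc _ _ _))

    sumL-filter : ∀ {p} {P : Pred A p} (P? : Decidable P) (f : A → Carrier) xs →
      sumL (map f (filter P? xs)) ≈ sumL (map (λ x → if does (P? x) then f x else 0#) xs)
    sumL-filter P? f []       = refl
    sumL-filter P? f (x ∷ xs) with does (P? x)
    ... | true  = +-congˡ (sumL-filter P? f xs)
    ... | false = trans (sumL-filter P? f xs) (sym (+-identityˡ _))

  sumL-concatMap : ∀ {a b} {A : Set a} {B : Set b} (f : B → Carrier) (g : A → List B) xs →
    sumL (map f (concatMap g xs)) ≈ sumL (map (λ x → sumL (map f (g x))) xs)
  sumL-concatMap f g []       = refl
  sumL-concatMap f g (x ∷ xs) =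
    trans (sumL-++ f (g x) (concatMap g xs)) (+-congˡ (sumL-concatMap f g xs))

  sumL-cartesianProduct : ∀ {a b} {A : Set a} {B : Set b} (f : A × B → Carrier) xs ys →
    sumL (map f (cartesianProduct xs ys)) ≈ sumL (map (λ x → sumL (map (λ y → f (x , y)) ys)) xs)
  sumL-cartesianProduct f []       ys = refl
  sumL-cartesianProduct f (x ∷ xs) ys = trans (sumL-++ f (map (x ,_) ys) _)
    (+-cong (reflexive (≡.cong sumL (≡.sym (map-∘ ys)))) (sumL-cartesianProduct f xs ys))

  sumL-insertAll : ∀ {a} {A : Set a} {n} x (v : Vec A n) (φ : List A → Carrier) →
    sumL (map (φ ∘ toList) (insertAll x v)) ≈ insertSum x (toList v) φ
  sumL-insertAll x Vec.[]      φ = +-identityʳ _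
  sumL-insertAll x (y Vec.∷ v) φ = +-congˡ
    (trans (reflexive (≡.cong sumL (≡.sym (map-∘ (insertAll x v)))))
           (sumL-insertAll x v (φ ∘ (y ∷_))))

  -- Both enumerations insert 0 last, into the permutations of the shifted letters, so their
  -- recursions match.
  sumL-perms : ∀ n (φ : List (Fin n) → Carrier) →
    sumL (map (φ ∘ toList) (perms n)) ≈ permSum (allFin n) φ
  sumL-perms zero    φ = +-identityʳ _
  sumL-perms (suc n) φ = begin
    sumL (map (φ ∘ toList) (perms (suc n)))
      ≈⟨ sumL-concatMap (φ ∘ toList) (λ v → insertAll Fin.zero (Vec.map Fin.suc v)) (perms n) ⟩
    sumL (map (λ v → sumL (map (φ ∘ toList) (insertAll Fin.zero (Vec.map Fin.suc v)))) (perms n))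
      ≈⟨ sumL-cong (perms n) (λ v _ → trans (sumL-insertAll Fin.zero (Vec.map Fin.suc v) φ)
           (reflexive (≡.cong (λ w → insertSum Fin.zero w φ) (Vec.toList-map Fin.suc v)))) ⟩
    sumL (map (λ v → insertSum Fin.zero (map Fin.suc (toList v)) φ) (perms n))
      ≈⟨ sumL-perms n (λ w → insertSum Fin.zero (map Fin.suc w) φ) ⟩
    permSum (allFin n) (λ w → insertSum Fin.zero (map Fin.suc w) φ)
      ≈⟨ permSum-map Fin.suc (allFin n) (λ w → insertSum Fin.zero w φ) ⟨
    permSum (Fin.zero ∷ map Fin.suc (allFin n)) φ
      ≡⟨ ≡.cong (λ l → permSum l φ) (allFin-suc n) ⟨
    permSum (allFin (suc n)) φ
      ∎
    where open import Relation.Binary.Reasoning.Setoid setoid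


-- The coefficients of the twisted square.

module _ {c ℓ} (L : Field c ℓ) where
  open Field L
  open Twisted L
  open WordSums L
  open ListSums L
  open import Relation.Binary.Reasoning.Setoid setoid

  module _ {n : ℕ} (q : Fin n → Carrier) where
    open Klyachko L q

    -- `take k` drops the product of all k + 1 letters, just as no cut lies behind the last letter.
    -- A general p carries the induction.
    numer≡cutProduct : ∀ {k} p (v : Vec (Fin n) (suc k)) →
      prodL (zipWith _⟨_⟩ (descBits (toList v)) (take k (partials p (map q (toList v)))))
        ≡ cutProduct (λ a b → b ≺ a) p (toList v)
    numer≡cutProduct p (a Vec.∷ Vec.[])     = ≡.refl
    numer≡cutProduct p (a Vec.∷ b Vec.∷ v) = ≡.cong (_ *_) (numer≡cutProduct (p * q a) (b Vec.∷ v))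

    denom≡cutDenom : ∀ {k} p (v : Vec (Fin n) (suc k)) →
      prodL (map (λ x → 1# - x) (take k (partials p (map q (toList v))))) ≡ cutDenom p (toList v)
    denom≡cutDenom p (a Vec.∷ Vec.[])     = ≡.refl
    denom≡cutDenom p (a Vec.∷ b Vec.∷ v) = ≡.cong (_ *_) (denom≡cutDenom (p * q a) (b Vec.∷ v))

    cutDenom-resonant : ∀ p x u y v → p * weight (x ∷ u) ≈ 1# →
      cutDenom p ((x ∷ u) ++ y ∷ v) ≈ 0#
    cutDenom-resonant p x []       y v e = trans
      (*-congʳ (trans (+-congˡ (-‿cong (trans (*-congˡ (sym (*-identityʳ _))) e))) (-‿inverseʳ 1#)))
      (zeroˡ _)
    cutDenom-resonant p x (x′ ∷ u) y v e = trans
      (*-congˡ (cutDenom-resonant (p * q x) x′ u y v (trans (*-assoc _ _ _) e)))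
      (zeroʳ _)

  module _ {n k : ℕ} (q : Fin n → Carrier) (f : Fin k → Fin n) where

    -- σ acts on a coefficient by substituting q ∘ `lookup σ`. The substitution is moved from the
    -- variables to the letters, which turns the word ρ into σρ.
    cutProduct-map : ∀ {R R′} → (∀ i j → R i j ≡ R′ (f i) (f j)) → ∀ p l →
      Klyachko.cutProduct L (q ∘ f) R p l ≡ Klyachko.cutProduct L q R′ p (map f l)
    cutProduct-map h p []          = ≡.refl
    cutProduct-map h p (a ∷ [])    = ≡.refl
    cutProduct-map h p (a ∷ b ∷ l) =
      ≡.cong₂ (λ c z → (if c then p * q (f a) else 1#) * z) (h a b) (cutProduct-map h _ (b ∷ l))

    cutDenom-map : ∀ p l → Klyachko.cutDenom L (q ∘ f) p l ≡ Klyachko.cutDenom L q p (map f l)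
    cutDenom-map p []          = ≡.refl
    cutDenom-map p (a ∷ [])    = ≡.refl
    cutDenom-map p (a ∷ b ∷ l) = ≡.cong (_ *_) (cutDenom-map _ (b ∷ l))

  module _ {m : ℕ} (q : Fin (suc m) → Carrier)
    (weight≈1 : prodL (map q (allFin (suc m))) ≈ 1#)
    (denom≉0 : ∀ σ → σ ∈ perms (suc m) → ¬ (denom q σ ≈ 0#)) where
    open Klyachko L q

    -- A proper part of weight 1, put at the front of a word, gives the factor 1 - 1 at the cut
    -- before y, so the denominator of that permutation would vanish.
    nonResonant : ∀ x u y v → (x ∷ u) ++ y ∷ v ↭ allFin (suc m) → ¬ (weight (x ∷ u) ≈ 1#)
    nonResonant x u y v p e with σ , σ∈ , eq ← perms-complete (suc m) p =
      denom≉0 σ σ∈ (begin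
        denom q σ                       ≡⟨ denom≡cutDenom q 1# σ ⟩
        cutDenom 1# (toList σ)          ≡⟨ ≡.cong (cutDenom 1#) eq ⟩
        cutDenom 1# ((x ∷ u) ++ y ∷ v)  ≈⟨ cutDenom-resonant q 1# x u y v (trans (*-identityˡ _) e) ⟩
        0#                              ∎)

    eCoeff≈suffixCoeff : ∀ σ → σ ∈ perms (suc m) → eCoeff q σ ≈ suffixCoeff (toList σ)
    eCoeff≈suffixCoeff σ@(a Vec.∷ w) σ∈ = begin
      numer q σ * denom q σ ⁻¹
        ≈⟨ *-congʳ numer≈ ⟩
      suffixCoeff (toList σ) * denom q σ * denom q σ ⁻¹
        ≈⟨ trans (*-assoc _ _ _) (trans (*-congˡ (inverseʳ _ (denom≉0 σ σ∈))) (*-identityʳ _)) ⟩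
      suffixCoeff (toList σ)
        ∎
      where
      numer≈ : numer q σ ≈ suffixCoeff (toList σ) * denom q σ
      numer≈ = begin
        numer q σ
          ≡⟨ numer≡cutProduct q 1# σ ⟩
        cutProduct (λ a b → b ≺ a) 1# (toList σ)
          ≈⟨ suffixCoeff-cutDenom a (toList w) 1# (perms-unique σ∈)
               (λ x u v p → nonResonant x u a v
                 (↭-trans (shift a (x ∷ u) v) (↭-trans (prep a p) (perms-↭ (suc m) σ∈))))
               (trans (*-identityˡ _) (trans (weight-↭ (perms-↭ (suc m) σ∈)) weight≈1)) ⟨
        suffixCoeff (toList σ) * cutDenom 1# (toList σ)
          ≡⟨ ≡.cong (suffixCoeff (toList σ) *_) (denom≡cutDenom q 1# σ) ⟨
        suffixCoeff (toList σ) * denom q σ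
          ∎

    -- The descents of ρ = σ⁻¹ τ are the j for which τ (j + 1) precedes τ (j) in the word σ.
    eCoeff-twisted : ∀ σ ρ → Unique (toList σ) →
      eCoeff (λ i → q (lookup σ i)) ρ
        ≡ cutProduct (λ a b → precedes Fin._≟_ (toList σ) b a) 1# (toList (σ ∘ₚ ρ))
            * denom q (σ ∘ₚ ρ) ⁻¹
    eCoeff-twisted σ ρ uniq = ≡.cong₂ (λ x y → x * y ⁻¹)
      (≡.trans (numer≡cutProduct (q ∘ lookup σ) 1# ρ)
        (≡.trans
          (cutProduct-map q (lookup σ) (λ i j → ≡.sym (precedes-lookup Fin._≟_ σ uniq j i)) 1# (toList ρ))
          (≡.cong (cutProduct _ 1#) (≡.sym (Vec.toList-map (lookup σ) ρ)))))
      (≡.trans (denom≡cutDenom (q ∘ lookup σ) 1# ρ)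
        (≡.trans (cutDenom-map q (lookup σ) 1# (toList ρ))
          (≡.trans (≡.cong (cutDenom 1#) (≡.sym (Vec.toList-map (lookup σ) ρ)))
            (≡.sym (denom≡cutDenom q 1# (σ ∘ₚ ρ))))))

    idempotent : ∀ τ → τ ∈ perms (suc m) → (eCoeff ⋉ eCoeff) q τ ≈ eCoeff q τ
    idempotent τ@(t Vec.∷ rest) τ∈ = begin
      (eCoeff ⋉ eCoeff) q τ
        ≈⟨ trans (sumL-filter (λ x → Vec.≡-dec Fin._≟_ (proj₁ x ∘ₚ proj₂ x) τ) f (cartesianProduct ps ps))
             (sumL-cartesianProduct _ ps ps) ⟩
      sumL (map (λ σ → sumL (map (λ ρ →
        if does (Vec.≡-dec Fin._≟_ (σ ∘ₚ ρ) τ) then f (σ , ρ) else 0#) ps)) ps)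
        ≈⟨ sumL-cong ps inner ⟩
      sumL (map (term ∘ toList) ps)
        ≈⟨ sumL-perms (suc m) term ⟩
      permSum (allFin (suc m)) term
        -- From here the letters are inserted in the order of τ, so that each cut of τ concerns the
        -- letter just inserted and the one inserted before it.
        ≈⟨ permSum-↭ term (perms-↭ (suc m) τ∈) ⟨
      permSum τₗ term
        -- X, the inverse denominator of τ, is common to all terms; the trivial shuffle with r = []
        -- gives the form needed for the induction.
        ≈⟨ permSum-cong τₗ (λ w w↭ → trans
             (*-congʳ (reflexive (≡.sym
               (shuffleAfter-[] Fin._≟_ w suffixCoeff (∈-resp-↭ (↭-sym w↭) (here ≡.refl))))))
             (solve 3 (λ s c d → s :* (c :* d) := d :* (c :* s)) refl _ _ _)) ⟩
      permSum τₗ (λ w → X * (cutProduct (λ a b → precedes Fin._≟_ w b a) 1# τₗ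
                               * shuffleAfter Fin._≟_ t [] w suffixCoeff))
        ≈⟨ permSum-scale X τₗ _ ⟩
      X * permSum τₗ (λ w → cutProduct (λ a b → precedes Fin._≟_ w b a) 1# τₗ
                              * shuffleAfter Fin._≟_ t [] w suffixCoeff)
        ≈⟨ *-congˡ (permSum-shuffleAfter weight≈1 (allFin⁺ (suc m)) nonResonant t [] (toList rest) 1# refl
             (↭-trans (++-comm τₗ []) (perms-↭ (suc m) τ∈))) ⟩
      X * (1# * cutProduct (λ a b → b ≺ a) 1# τₗ)
        ≈⟨ trans (*-congˡ (*-identityˡ _)) (*-comm _ _) ⟩
      cutProduct (λ a b → b ≺ a) 1# τₗ * X
        ≡⟨ ≡.cong (_* X) (numer≡cutProduct q 1# τ) ⟨
      eCoeff q τ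
        ∎
      where
      open Solver using (solve; _:=_; _:*_)
      ps = perms (suc m)
      τₗ = toList τ
      X = denom q τ ⁻¹
      f : Perm (suc m) × Perm (suc m) → Carrier
      f (σ , ρ) = eCoeff q σ * eCoeff (λ i → q (lookup σ i)) ρ
      term : List (Fin (suc m)) → Carrier
      term w = suffixCoeff w * (cutProduct (λ a b → precedes Fin._≟_ w b a) 1# τₗ * X)
      -- As ρ runs over all permutations, so does the word σρ; exactly one term of the sum over ρ
      -- equals τ.
      inner : ∀ σ → σ ∈ ps →
        sumL (map (λ ρ → if does (Vec.≡-dec Fin._≟_ (σ ∘ₚ ρ) τ) then f (σ , ρ) else 0#) ps)
          ≈ term (toList σ)
      inner σ σ∈ = begin
        sumL (map (λ ρ → if does (Vec.≡-dec Fin._≟_ (σ ∘ₚ ρ) τ) then f (σ , ρ) else 0#) ps)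
          ≈⟨ sumL-cong ps (λ ρ _ → select ρ) ⟩
        sumL (map (λ ρ → δ (map (lookup σ) (toList ρ))) ps)
          ≈⟨ sumL-perms (suc m) (δ ∘ map (lookup σ)) ⟩
        permSum (allFin (suc m)) (δ ∘ map (lookup σ))
          ≈⟨ permSum-map (lookup σ) (allFin (suc m)) δ ⟨
        permSum (map (lookup σ) (allFin (suc m))) δ
          ≈⟨ permSum-↭ δ (↭-trans (↭-reflexive (map-lookup-allFin σ))
               (↭-trans (perms-↭ (suc m) σ∈) (↭-sym (perms-↭ (suc m) τ∈)))) ⟩
        permSum τₗ δ
          ≈⟨ permSum-δ Fin._≟_ τₗ (term (toList σ)) (perms-unique τ∈) ⟩
        term (toList σ)
          ∎
        where
        δ : List (Fin (suc m)) → Carrier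
        δ w = if does (≡-dec Fin._≟_ w τₗ) then term (toList σ) else 0#
        select : ∀ ρ →
          (if does (Vec.≡-dec Fin._≟_ (σ ∘ₚ ρ) τ) then f (σ , ρ) else 0#)
            ≈ δ (map (lookup σ) (toList ρ))
        select ρ with Vec.≡-dec Fin._≟_ (σ ∘ₚ ρ) τ
        ... | yes e rewrite dec-true (≡-dec Fin._≟_ (map (lookup σ) (toList ρ)) τₗ)
                              (≡.trans (≡.sym (Vec.toList-map (lookup σ) ρ)) (≡.cong toList e)) =
          *-cong (eCoeff≈suffixCoeff σ σ∈)
            (trans (reflexive (eCoeff-twisted σ ρ (perms-unique σ∈)))
              (reflexive (≡.cong (λ v →
                cutProduct (λ a b → precedes Fin._≟_ (toList σ) b a) 1# (toList v) * denom q v ⁻¹) e)))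
        ... | no ≢τ rewrite dec-false (≡-dec Fin._≟_ (map (lookup σ) (toList ρ)) τₗ)
                              (λ e → ≢τ (toList-injective (≡.trans (Vec.toList-map (lookup σ) ρ) e))) =
          refl

  fullQ-weight : ∀ {m} (q : Vec Carrier m) → ¬ (prodL (toList q) ≈ 0#) →
    prodL (map (fullQ q) (allFin (suc m))) ≈ 1#
  fullQ-weight {m} q q≉0 = begin
    prodL (map (fullQ q) (allFin (suc m)))
      ≡⟨ ≡.cong prodL (≡.trans (map-lookup-allFin (q ∷ʳ (prodL (toList q)) ⁻¹)) (Vec.toList-∷ʳ _ q)) ⟩
    prodL (toList q ++ [ (prodL (toList q)) ⁻¹ ])
      ≈⟨ prodL-snoc (toList q) _ ⟩
    prodL (toList q) * (prodL (toList q)) ⁻¹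
      ≈⟨ inverseʳ _ q≉0 ⟩
    1#
      ∎
    where
    prodL-snoc : ∀ xs y → prodL (xs ++ [ y ]) ≈ prodL xs * y
    prodL-snoc []       y = *-comm _ _
    prodL-snoc (x ∷ xs) y = trans (*-congˡ (prodL-snoc xs y)) (sym (*-assoc _ _ _))

-- For L = K(q) and the variables themselves as q, the hypotheses hold because no product of a
-- proper nonempty set of the n variables is 1; the conclusion is then the equality of the
-- coefficients at τ.
theorem1p8 : ∀ {c ℓ} (L : Field c ℓ) → Field.HasCharZero L →
    (m : ℕ) (q : Vec (Field.Carrier L) m) →
    ¬ (Field._≈_ L (Twisted.prodL L (toList q)) (Field.0# L)) →
    (∀ σ → σ ∈ perms (suc m) →
    ¬ (Field._≈_ L (Twisted.denom L (Twisted.fullQ L q) σ) (Field.0# L))) →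
    ∀ τ → τ ∈ perms (suc m) →
    Field._≈_ L
    (Twisted._⋉_ L (Twisted.eCoeff L) (Twisted.eCoeff L) (Twisted.fullQ L q) τ)
    (Twisted.eCoeff L (Twisted.fullQ L q) τ)
theorem1p8 L _ m q q≉0 denom≉0 = idempotent L (Twisted.fullQ L q) (fullQ-weight L q q≉0) denom≉0
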